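{- Let $n\ge 1$. The complete graph $K_n$ is a unit rectangle visibility graph if and only if $n\le 4$.
   Context: A finite simple graph $G$ is a unit rectangle visibility graph (URVG) if its vertices $v$ can be represented by closed unit squares $S_v$ in the plane with sides parallel to the coordinate axes and with pairwise disjoint interiors (squares may touch along their boundaries), in such a way that two distinct vertices $v,w$ are adjacent if and only if there is an unobstructed non-degenerate (positive width) horizontal or vertical band of visibility joining $S_v$ and $S_w$. Here a horizontal band of visibility joining $S_v$ and $S_w$ is given by an open interval $I$ of positive length such that for every $y_0\in I$ the line $y=y_0$ meets the interiors of both $S_v$ and $S_w$, and the part of this line between $S_v$ and $S_w$ (possibly a single point if the squares touch) meets the interior of no other square of the representation; vertical bands are defined analogously with the roles of $x$ and $y$ exchanged. -}

module Defs where

open import Data.Empty using (⊥)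
open import Data.Fin.Base using (Fin)
open import Data.Nat.Base using (ℕ)
open import Data.Product.Base using (Σ; ∃-syntax; _×_; _,_; swap)
open import Data.Rational.Base using (ℚ; 1ℚ; _+_; _-_; -_) renaming (_<_ to _<ℚ_)
open import Data.Rational.Properties
  using (+-assoc; +-inverseˡ; +-inverseʳ; +-identityʳ; +-monoˡ-<)
open import Data.Sum.Base using (_⊎_)
open import Function.Base using (_∘_)
open import Function.Bundles using (_⇔_)
open import Relation.Binary.PropositionalEquality
  using (_≡_; _≢_; refl; sym; trans; cong; subst; ≢-sym)
open import Relation.Nullary.Negation.Core using (¬_)

-- Real numbers as two-sided Dedekind cuts: `L q` means q < x, `U q` means x < q.
record ℝ : Set₁ where
  field
    L U         : ℚ → Set
    L-inhabited : ∃[ q ] L q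
    U-inhabited : ∃[ q ] U q
    L-lower     : ∀ {q r} → q <ℚ r → L r → L q
    U-upper     : ∀ {q r} → q <ℚ r → U q → U r
    L-open      : ∀ {q} → L q → ∃[ r ] (q <ℚ r × L r)
    U-open      : ∀ {r} → U r → ∃[ q ] (q <ℚ r × U q)
    disjoint    : ∀ {q} → L q → U q → ⊥
    located     : ∀ {q r} → q <ℚ r → L q ⊎ U r

open ℝ

infix 4 _<_ _≤_

_<_ : ℝ → ℝ → Set
x < y = ∃[ q ] (U x q × L y q)

_≤_ : ℝ → ℝ → Set
x ≤ y = ¬ (y < x)

private
  q+p-p≡q : ∀ q p → (q + p) - p ≡ q
  q+p-p≡q q p = trans (+-assoc q p (- p)) (trans (cong (q +_) (+-inverseʳ p)) (+-identityʳ q))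

  q-p+p≡q : ∀ q p → (q - p) + p ≡ q
  q-p+p≡q q p = trans (+-assoc q (- p) p) (trans (cong (q +_) (+-inverseˡ p)) (+-identityʳ q))

  -<⇒<+ : ∀ {q r} p → q - p <ℚ r → q <ℚ r + p
  -<⇒<+ {q} {r} p lt = subst (_<ℚ r + p) (q-p+p≡q q p) (+-monoˡ-< p lt)

  <-⇒+< : ∀ {q r} p → q <ℚ r - p → q + p <ℚ r
  <-⇒+< {q} {r} p lt = subst (q + p <ℚ_) (q-p+p≡q r p) (+-monoˡ-< p lt)

infixl 6 _⊕_

-- Sum of a real and a rational: q < x + p iff q - p < x, and dually.
_⊕_ : ℝ → ℚ → ℝ
x ⊕ p = record
  { L           = λ q → L x (q - p)
  ; U           = λ q → U x (q - p)
  ; L-inhabited = let (q , l) = L-inhabited x in q + p , subst (L x) (sym (q+p-p≡q q p)) l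
  ; U-inhabited = let (q , u) = U-inhabited x in q + p , subst (U x) (sym (q+p-p≡q q p)) u
  ; L-lower     = λ q<r → L-lower x (+-monoˡ-< (- p) q<r)
  ; U-upper     = λ q<r → U-upper x (+-monoˡ-< (- p) q<r)
  ; L-open      = λ l → let (r , lt , l′) = L-open x l in
                    r + p , -<⇒<+ p lt , subst (L x) (sym (q+p-p≡q r p)) l′
  ; U-open      = λ u → let (q , lt , u′) = U-open x u in
                    q + p , <-⇒+< p lt , subst (U x) (sym (q+p-p≡q q p)) u′
  ; disjoint    = disjoint x
  ; located     = λ q<r → located x (+-monoˡ-< (- p) q<r)
  }

Point : Set₁
Point = ℝ × ℝ

-- A closed axis-parallel unit square [a , a + 1] × [b , b + 1] is given by its
-- lower left corner (a , b).
Square : Set₁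
Square = Point

_∈Interior_ : Point → Square → Set
(x , y) ∈Interior (a , b) = (a < x × x < a ⊕ 1ℚ) × (b < y × y < b ⊕ 1ℚ)

LineMeets : ℝ → Square → Set₁
LineMeets y S = ∃[ x ] ((x , y) ∈Interior S)

-- The abscissa x is at or to the right of the right side of one of the squares, and at
-- or to the left of the left side of the other.
Between : Square → Square → ℝ → Set
Between (a , _) (c , _) x = (a ⊕ 1ℚ ≤ x × x ≤ c) ⊎ (c ⊕ 1ℚ ≤ x × x ≤ a)

Layout : ℕ → Set₁
Layout n = Fin n → Square

DisjointInteriors : ∀ {n} → Layout n → Set₁
DisjointInteriors S = ∀ {v w} → v ≢ w → ∀ p → ¬ (p ∈Interior S v × p ∈Interior S w)

record HorizontalBand {n} (S : Layout n) (v w : Fin n) : Set₁ where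
  field
    lo hi        : ℝ
    lo<hi        : lo < hi
    meets        : ∀ y → lo < y → y < hi → LineMeets y (S v) × LineMeets y (S w)
    unobstructed : ∀ y → lo < y → y < hi →
                   ∀ x → Between (S v) (S w) x →
                   ∀ u → u ≢ v → u ≢ w → ¬ ((x , y) ∈Interior S u)

-- Reflecting the plane in the diagonal exchanges the roles of x and y.
VerticalBand : ∀ {n} → Layout n → Fin n → Fin n → Set₁
VerticalBand S = HorizontalBand (swap ∘ S)

Visible : ∀ {n} → Layout n → Fin n → Fin n → Set₁
Visible S v w = HorizontalBand S v w ⊎ VerticalBand S v w

record SimpleGraph (n : ℕ) : Set₁ where
  field
    Adj         : Fin n → Fin n → Set
    symmetric   : ∀ {v w} → Adj v w → Adj w v
    irreflexive : ∀ {v} → ¬ Adj v v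

open SimpleGraph

K : ∀ n → SimpleGraph n
K n = record
  { Adj         = _≢_
  ; symmetric   = ≢-sym
  ; irreflexive = λ v≢v → v≢v refl
  }

IsURVG : ∀ {n} → SimpleGraph n → Set₁
IsURVG {n} G =
  Σ (Layout n) λ S →
    DisjointInteriors S × (∀ {v w} → v ≢ w → Adj G v w ⇔ Visible S v w)

{-# OPTIONS --safe #-}
-- Two squares whose interiors are disjoint and which see each other overlap in exactly one
-- coordinate projection, so a complete representation splits the pairs into vertical and
-- horizontal ones.  Among five squares the leftmost one has two vertical or three
-- horizontal neighbours, and either way there is a triangle of one kind, say vertical:
-- a below b below c.  As a sees c, the square b does not cover their common shadow, hence
-- sticks out at one side, say the left.  Then each of the two remaining squares lies to the
-- right of b and is seen by b horizontally; they see each other vertically, and the lower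
-- one must be both strictly to the right (because of a) and strictly to the left (because
-- of c) of the upper one.
--
-- All these comparisons of reals are negative statements and the goal is absurdity, so
-- the order of the finitely many coordinates may be taken to be decidable.
module Submission where

open import Defs
open import Data.Fin.Base using (Fin; zero; suc; punchIn; inject≤)
open import Data.Fin.Patterns using (0F; 1F; 2F; 3F)
open import Data.Fin.Properties as Fin
  using (all?; any?; pigeonhole; sequence; inject≤-injective; punchIn-injective; punchInᵢ≢i)
open import Data.Empty using (⊥)
open import Data.Integer.Base as ℤ using (+_; -[1+_])
import Data.Integer.Properties as ℤ
open import Data.List.Base using (List; []; _∷_; length; lookup)
import Data.List.Membership.DecPropositional as DecMembership
open import Data.List.Membership.Propositional using (_∈_; _∉_)
open import Data.List.Relation.Unary.Any using (here; there; index)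
open import Data.List.Relation.Unary.Any.Properties using (lookup-index)
open import Data.Nat.Base as ℕ using (ℕ; zero; suc) renaming (_≤_ to _≤ℕ_)
open import Data.Nat.Coprimality using (1-coprimeTo) renaming (sym to coprime-sym)
import Data.Nat.Properties as ℕ
open import Data.Product.Base as Product using (∃-syntax; _×_; _,_; proj₁; proj₂; swap)
open import Data.Rational.Base as ℚ using (ℚ; mkℚ; 0ℚ; ½; 1ℚ; _+_; _-_; -_)
import Data.Rational.Properties as ℚ
import Data.Rational.Unnormalised.Base as ℚᵘ
import Data.Rational.Unnormalised.Properties as ℚᵘ
open import Data.Sum.Base as Sum using (_⊎_; inj₁; inj₂; [_,_]′)
open import Effect.Monad using (RawMonad)
open import Function.Base using (flip; _∘_; id)
open import Function.Bundles using (_⇔_; mk⇔; module Equivalence)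
open import Function.Definitions using (Injective)
open import Relation.Binary.Definitions using (tri<; tri≈; tri>)
open import Relation.Binary.PropositionalEquality
  using (_≡_; _≢_; refl; sym; trans; cong; subst; ≢-sym)
open import Relation.Nullary.Decidable
  using (Dec; yes; no; True; toWitness; from-yes; ¬?; _×-dec_; _⊎-dec_; decidable-stable;
         ¬¬-excluded-middle)
open import Relation.Nullary.Negation using (¬¬-Monad)
open import Relation.Nullary.Negation.Core using (¬_; contradiction)

open import Algebra.Properties.AbelianGroup ℚ.+-0-abelianGroup
  using (xyx⁻¹≈y; //-rightDividesˡ; //-rightDividesʳ)

-- The order of the reals

ι : ℕ → ℚ
ι n = mkℚ (+ n) 0 (coprime-sym (1-coprimeTo n))

ι-suc : ∀ n → ι (suc n) ≡ 1ℚ + ι n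
ι-suc n = ℚ.toℚᵘ-injective (ℚᵘ.≃-trans (ℚᵘ.*≡* eq) (ℚᵘ.≃-sym (ℚ.toℚᵘ-homo-+ 1ℚ (ι n))))
  where
  eq : + suc n ℤ.* + 1 ≡ (+ 1 ℤ.+ + n ℤ.* + 1) ℤ.* + 1
  eq rewrite ℤ.*-identityʳ (+ n) = refl

archimedean : ∀ p → ∃[ n ] p ℚ.< ι n
archimedean (mkℚ -[1+ m ] d _) = 0 , ℚ.*<* ℤ.-<+
archimedean (mkℚ (+ m) d _) = suc m , ℚ.*<* lt
  where
  lt : + m ℤ.* + 1 ℤ.< + suc m ℤ.* + suc d
  lt rewrite ℤ.*-identityʳ (+ m) | sym (ℤ.pos-* (suc m) (suc d)) =
    ℤ.+<+ (ℕ.m≤m*n (suc m) (suc d))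

module _ (x : ℝ) where
  open ℝ x

  <-irrefl : ¬ x < x
  <-irrefl (_ , u , l) = disjoint l u

  L<U : ∀ {q r} → L q → U r → q ℚ.< r
  L<U {q} {r} l u with ℚ.<-cmp q r
  ... | tri< q<r _ _ = q<r
  ... | tri≈ _ refl _ = contradiction u (disjoint l)
  ... | tri> _ _ r<q = contradiction u (disjoint (L-lower r<q l))

  -- Otherwise the lower cut would be closed under adding 1.
  ¬¬x<x⊕1 : ¬ ¬ (x < x ⊕ 1ℚ)
  ¬¬x<x⊕1 x≮x⊕1 with L-inhabited | U-inhabited
  ... | l , Ll | u , Uu with archimedean (u - l)
  ...   | n , u-l<n = disjoint (climb n Ll) (U-upper u<l+n Uu)
    where
    up : ∀ {q} → L q → L (q + ½)
    -- Locatedness needs a strict gap, so `q + ½` is tested against `q + 1ℚ`; two half steps make up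
    -- each unit in `climb`.
    up {q} Lq with located (ℚ.+-monoʳ-< q (from-yes (½ ℚ.<? 1ℚ)))
    ... | inj₁ Lq+½ = Lq+½
    ... | inj₂ Uq+1 = contradiction (q + 1ℚ , Uq+1 , subst L (sym (//-rightDividesʳ 1ℚ q)) Lq) x≮x⊕1

    climb : ∀ n {q} → L q → L (q + ι n)
    climb zero    {q} Lq = subst L (sym (ℚ.+-identityʳ q)) Lq
    climb (suc n) {q} Lq = subst L eq (climb n (up (up Lq)))
      where
      eq : q + ½ + ½ + ι n ≡ q + ι (suc n)
      eq = trans (cong (_+ ι n) (ℚ.+-assoc q ½ ½))
             (trans (ℚ.+-assoc q 1ℚ (ι n)) (cong (λ p → q + p) (sym (ι-suc n))))

    u<l+n : u ℚ.< l + ι n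
    u<l+n = subst (ℚ._< l + ι n) (trans (sym (ℚ.+-assoc l u (- l))) (xyx⁻¹≈y l u))
              (ℚ.+-monoʳ-< l u-l<n)

<-trans : ∀ {x y z} → x < y → y < z → x < z
<-trans {x} {y} {z} (q , xq , yq) (r , yr , zr) = r , ℝ.U-upper x (L<U y yq yr) xq , zr

-- Stands in for trichotomy: openness of the upper cut of `x` leaves a rational gap below `q`,
-- across which `z` can be located.
<-cotrans : ∀ {x y} z → x < y → x < z ⊎ z < y
<-cotrans {x} z (q , xq , yq) with ℝ.U-open x xq
... | p , p<q , xp with ℝ.located z p<q
...   | inj₁ zp = inj₁ (p , xp , zp)
...   | inj₂ zq = inj₂ (q , zq , yq)

<⇒≤ : ∀ {x y} → x < y → x ≤ y
<⇒≤ {x} {y} x<y y<x = <-irrefl x (<-trans {x} {y} {x} x<y y<x)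

≤-<-trans : ∀ {x y z} → x ≤ y → y < z → x < z
≤-<-trans {x} {y} {z} x≤y y<z with <-cotrans {y} {z} x y<z
... | inj₁ y<x = contradiction y<x x≤y
... | inj₂ x<z = x<z

<-≤-trans : ∀ {x y z} → x < y → y ≤ z → x < z
<-≤-trans {x} {y} {z} x<y y≤z with <-cotrans {x} {y} z x<y
... | inj₁ x<z = x<z
... | inj₂ z<y = contradiction z<y y≤z

≤-trans : ∀ {x y z} → x ≤ y → y ≤ z → x ≤ z
≤-trans {x} {y} {z} x≤y y≤z z<x = y≤z (<-≤-trans {z} {x} {y} z<x x≤y)

⊕-cancel-< : ∀ {x y} p → x ⊕ p < y ⊕ p → x < y
⊕-cancel-< p (q , xq , yq) = q - p , xq , yq

⊕-mono-≤ : ∀ {x y} p → x ≤ y → x ⊕ p ≤ y ⊕ p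
⊕-mono-≤ {x} {y} p x≤y lt = x≤y (⊕-cancel-< {y} {x} p lt)

⊕-mono-< : ∀ {x y} p → x < y → x ⊕ p < y ⊕ p
⊕-mono-< {x} {y} p (q , xq , yq) =
  q + p , subst (ℝ.U x) (sym q+p-p≡q) xq , subst (ℝ.L y) (sym q+p-p≡q) yq
  where q+p-p≡q = //-rightDividesʳ p q

x≤x⊕1 : ∀ x → x ≤ x ⊕ 1ℚ
x≤x⊕1 x x⊕1<x = ¬¬x<x⊕1 x λ x<x⊕1 → <⇒≤ {x} {x ⊕ 1ℚ} x<x⊕1 x⊕1<x

fromℚ : ℚ → ℝ
fromℚ p = record
  { L           = ℚ._< p
  ; U           = p ℚ.<_
  ; L-inhabited = p - 1ℚ , subst (p - 1ℚ ℚ.<_) (ℚ.+-identityʳ p)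
                      (ℚ.+-monoʳ-< p (from-yes (- 1ℚ ℚ.<? 0ℚ)))
  ; U-inhabited = p + 1ℚ , subst (ℚ._< p + 1ℚ) (ℚ.+-identityʳ p)
                      (ℚ.+-monoʳ-< p (from-yes (0ℚ ℚ.<? 1ℚ)))
  ; L-lower     = ℚ.<-trans
  ; U-upper     = λ q<r p<q → ℚ.<-trans p<q q<r
  ; L-open      = ℚ.<-dense
  ; U-open      = λ p<r → let (q , p<q , q<r) = ℚ.<-dense p<r in q , q<r , p<q
  ; disjoint    = ℚ.<-asym
  ; located     = λ {q} {r} q<r → located {q} {r} q<r
  }
  where
  located : ∀ {q r} → q ℚ.< r → q ℚ.< p ⊎ p ℚ.< r
  located {q} q<r with ℚ.<-cmp q p
  ... | tri< q<p _ _  = inj₁ q<p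
  ... | tri≈ _ refl _ = inj₂ q<r
  ... | tri> _ _ p<q  = inj₂ (ℚ.<-trans p<q q<r)

<-dense : ∀ {x y} → x < y → ∃[ z ] (x < z × z < y)
<-dense {x} {y} (q , xq , yq) =
  fromℚ q , (let (p , p<q , xp) = ℝ.U-open x xq in p , xp , p<q)
          , (let (r , q<r , yr) = ℝ.L-open y yq in r , q<r , yr)

fromℚ-mono-≤ : ∀ {p q} → p ℚ.≤ q → fromℚ p ≤ fromℚ q
fromℚ-mono-≤ p≤q (r , q<r , r<p) = ℚ.<-irrefl refl (ℚ.<-trans (ℚ.<-≤-trans r<p p≤q) q<r)

-- Arrangements of squares

-- Unit intervals on a line: i ⊑ j compares left ends, i ⊲ j says that i ends no later
-- than j begins.
record Intervals (I : Set) : Set₁ where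
  infix 4 _⊑_ _⊲_
  field
    _⊑_ _⊲_   : I → I → Set
    ⊑-total   : ∀ i j → i ⊑ j ⊎ j ⊑ i
    ⊑-trans   : ∀ {i j k} → i ⊑ j → j ⊑ k → i ⊑ k
    ⊲⇒⊑       : ∀ {i j} → i ⊲ j → i ⊑ j
    ⊲-irrefl  : ∀ {i} → ¬ i ⊲ i
    ⊑-⊲-trans : ∀ {i j k} → i ⊑ j → j ⊲ k → i ⊲ k
    ⊲-⊑-trans : ∀ {i j k} → i ⊲ j → j ⊑ k → i ⊲ k

  ⊲-trans : ∀ {i j k} → i ⊲ j → j ⊲ k → i ⊲ k
  ⊲-trans ij jk = ⊲-⊑-trans ij (⊲⇒⊑ jk)

  ⊑-refl : ∀ {i} → i ⊑ i
  ⊑-refl {i} = [ id , id ]′ (⊑-total i i)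

  Close Apart : I → I → Set
  Close i j = ¬ i ⊲ j × ¬ j ⊲ i
  Apart i j = i ⊲ j ⊎ j ⊲ i

  leftmost : ∀ {n} (f : Fin (suc n) → I) → ∃[ m ] (∀ i → f m ⊑ f i)
  leftmost {zero} f = zero , λ { zero → ⊑-refl }
  leftmost {suc n} f with leftmost (f ∘ suc)
  ... | m , m⊑ with ⊑-total (f zero) (f (suc m))
  ...   | inj₁ 0⊑m = zero  , λ { zero → ⊑-refl ; (suc i) → ⊑-trans 0⊑m (m⊑ i) }
  ...   | inj₂ m⊑0 = suc m , λ { zero → m⊑0    ; (suc i) → m⊑ i }

-- Flipping `⊑` is sound because intervals of equal length have their right ends ordered like their
-- left ends.
reverse : ∀ {I} → Intervals I → Intervals I
reverse X = record
  { _⊑_       = flip _⊑_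
  ; _⊲_       = flip _⊲_
  ; ⊑-total   = flip ⊑-total
  ; ⊑-trans   = flip ⊑-trans
  ; ⊲⇒⊑       = ⊲⇒⊑
  ; ⊲-irrefl  = ⊲-irrefl
  ; ⊑-⊲-trans = flip ⊲-⊑-trans
  ; ⊲-⊑-trans = flip ⊑-⊲-trans
  }
  where open Intervals X

module _ {I : Set} where

  -- Vertical X Y with X the horizontal and Y the vertical extents of the squares;
  -- horizontal position is Vertical Y X.
  Vertical : (X Y : Intervals I) → I → I → Set
  Vertical X Y i j = X.Close i j × Y.Apart i j
    where
    module X = Intervals X
    module Y = Intervals Y

  -- If p and q lie vertically between i and k, p reaching at least as far to the left
  -- and q at least as far to the right as the common shadow of i and k, then some of
  -- that shadow is uncovered only if there is a gap between p and q.  The case p = q,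
  -- where there is no gap, covers obstruction by a single square.
  Unblocked : (X Y : Intervals I) → Set
  Unblocked X Y = ∀ {i k p q} → X.Close i k →
    i Y.⊲ p → p Y.⊲ k → i Y.⊲ q → q Y.⊲ k →
    p X.⊑ i ⊎ p X.⊑ k → i X.⊑ q ⊎ k X.⊑ q → p X.⊲ q
    where
    module X = Intervals X
    module Y = Intervals Y

  record Arrangement (X Y : Intervals I) : Set where
    field
      sees       : ∀ {i j} → i ≢ j → Vertical X Y i j ⊎ Vertical Y X i j
      unblocked  : Unblocked X Y
      unblockedᵀ : Unblocked Y X

  transpose : ∀ {X Y} → Arrangement X Y → Arrangement Y X
  transpose A = record
    { sees = Sum.swap ∘ sees ; unblocked = unblockedᵀ ; unblockedᵀ = unblocked }
    where open Arrangement A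

  reverseʸ : ∀ {X Y} → Arrangement X Y → Arrangement X (reverse Y)
  reverseʸ A = record
    { sees       = Sum.map (Product.map₂ Sum.swap) (Product.map₁ swap) ∘ sees
    -- Turning upside down exchanges `i` with `k` here; in `unblockedᵀ`, where it reverses the
    -- direction of the gap, it exchanges `p` with `q`.
    ; unblocked  = λ ik pi kp qi kq p q →
        unblocked (swap ik) kp pi kq qi (Sum.swap p) (Sum.swap q)
    ; unblockedᵀ = λ ik ip pk iq qk p q → unblockedᵀ (swap ik) iq qk ip pk q p
    }
    where open Arrangement A

  reverseˣ : ∀ {X Y} → Arrangement X Y → Arrangement (reverse X) Y
  reverseˣ = transpose ∘ reverseʸ ∘ transpose

  record Triangle (X Y : Intervals I) (a b c : I) : Set where
    private
      module X = Intervals X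
      module Y = Intervals Y
    field
      a⊲b : a Y.⊲ b
      b⊲c : b Y.⊲ c
      a~b : X.Close a b
      b~c : X.Close b c
      a~c : X.Close a c

    BulgesLeft : Set
    BulgesLeft = b X.⊑ a × b X.⊑ c

  flipTriangle : ∀ {X Y a b c} → Triangle X Y a b c → Triangle X (reverse Y) c b a
  flipTriangle T = record
    { a⊲b = b⊲c ; b⊲c = a⊲b
    ; a~b = swap b~c ; b~c = swap a~b ; a~c = swap a~c }
    where open Triangle T

  mirrorTriangle : ∀ {X Y a b c} → Triangle X Y a b c → Triangle (reverse X) Y a b c
  mirrorTriangle T = record
    { a⊲b = a⊲b ; b⊲c = b⊲c
    ; a~b = swap a~b ; b~c = swap b~c ; a~c = swap a~c }
    where open Triangle T

  module _ {X Y : Intervals I} (A : Arrangement X Y) where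
    private
      module X = Intervals X
      module Y = Intervals Y
    open Arrangement A

    notBetween : ∀ {i j k} → X.Close i k → i Y.⊲ j → j Y.⊲ k →
                 j X.⊑ i ⊎ j X.⊑ k → i X.⊑ j ⊎ k X.⊑ j → ⊥
    notBetween ik ij jk l r = X.⊲-irrefl (unblocked ik ij jk ij jk l r)

    -- Depending on the left end of `c`, either `c` alone hides `b` or `a` from `d`, or `b` on the
    -- left and `c` on the right form a barrier without a gap between `a` and `d`.
    noChainOfFour : ∀ {a b c d} → a Y.⊲ b → b Y.⊲ c → c Y.⊲ d →
                    X.Close a d → X.Close b d → ¬ b X.⊲ c → b X.⊑ a → b X.⊑ c → ⊥
    noChainOfFour {a} {b} {c} {d} ab bc cd a~d b~d b⋪c b⊑a b⊑c with X.⊑-total c d | X.⊑-total c a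
    ... | inj₁ c⊑d | _        = notBetween b~d bc cd (inj₂ c⊑d) (inj₁ b⊑c)
    ... | inj₂ d⊑c | inj₁ c⊑a = notBetween a~d (Y.⊲-trans ab bc) cd (inj₁ c⊑a) (inj₂ d⊑c)
    ... | inj₂ d⊑c | inj₂ a⊑c =
      b⋪c (unblocked a~d ab (Y.⊲-trans bc cd) (Y.⊲-trans ab bc) cd (inj₁ b⊑a) (inj₁ a⊑c))

    module _ {a b c} (T : Triangle X Y a b c) (bulge : Triangle.BulgesLeft T) where
      open Triangle T
      private
        b⊑a = proj₁ bulge
        b⊑c = proj₂ bulge

      -- Such a `d` would see `a` vertically. Beginning left of `b`, it is hidden from `a` by `b`.
      -- Otherwise, a vertical view of `c` gives a chain of four, and a horizontal one pushes `c` or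
      -- `d` past the right end of `b`.
      noneAbove : ∀ {d} → d ≢ a → d ≢ c → b Y.⊲ d → ¬ X.Close b d
      noneAbove {d} d≢a d≢c b⊲d b~d with sees d≢a
      ... | inj₂ (d~a , _) = proj₂ d~a (Y.⊲-trans a⊲b b⊲d)
      ... | inj₁ (d~a , _) with X.⊑-total d b
      ...   | inj₁ d⊑b = notBetween (swap d~a) a⊲b b⊲d (inj₁ b⊑a) (inj₂ d⊑b)
      ...   | inj₂ b⊑d with sees d≢c
      ...     | inj₁ (_ , inj₁ d⊲c) = noChainOfFour a⊲b b⊲d d⊲c a~c b~c (proj₁ b~d) b⊑a b⊑d
      ...     | inj₁ (_ , inj₂ c⊲d) =
                  noChainOfFour a⊲b b⊲c c⊲d (swap d~a) b~d (proj₁ b~c) b⊑a b⊑c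
      ...     | inj₂ (_ , inj₁ d⊲c) = proj₁ b~c (X.⊑-⊲-trans b⊑d d⊲c)
      ...     | inj₂ (_ , inj₂ c⊲d) = proj₁ b~d (X.⊑-⊲-trans b⊑c c⊲d)

      -- The full unit height of `b` separates `a` from `c`, too much for one unit interval to
      -- overlap both.
      notBesideBoth : ∀ {d} → ¬ (Y.Close d a × Y.Close d c)
      notBesideBoth {d} (d~a , d~c) with Y.⊑-total d b
      ... | inj₁ d⊑b = proj₁ d~c (Y.⊑-⊲-trans d⊑b b⊲c)
      ... | inj₂ b⊑d = proj₂ d~a (Y.⊲-⊑-trans a⊲b b⊑d)

  module _ {X Y : Intervals I} (A : Arrangement X Y) {a b c : I}
           (T : Triangle X Y a b c) (bulge : Triangle.BulgesLeft T) where
    open Arrangement A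
    open Triangle T
    private
      module X = Intervals X
      module Y = Intervals Y
      b⊑a = proj₁ bulge
      b⊑c = proj₂ bulge

    beside : ∀ {d} → d ≢ a → d ≢ b → d ≢ c →
             Y.Close d b × b X.⊲ d × (X.Close d a ⊎ X.Close d c)
    beside {d} d≢a d≢b d≢c = d~b , b⊲d , meets
      where
      level : Vertical Y X d b
      level with sees d≢b
      ... | inj₂ h = h
      ... | inj₁ (d~b , inj₂ b⊲d) =
        contradiction (swap d~b) (noneAbove A T bulge d≢a d≢c b⊲d)
      ... | inj₁ (d~b , inj₁ d⊲b) =
        contradiction (swap d~b)
          (noneAbove (reverseʸ A) (flipTriangle T) (b⊑c , b⊑a) d≢c d≢a d⊲b)

      d~b = proj₁ level

      meets : X.Close d a ⊎ X.Close d c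
      meets with sees d≢a | sees d≢c
      ... | inj₁ (d~a , _) | _              = inj₁ d~a
      ... | inj₂ _         | inj₁ (d~c , _) = inj₂ d~c
      ... | inj₂ (d~a , _) | inj₂ (d~c , _) = contradiction (d~a , d~c) (notBesideBoth A T bulge)

      -- On the left of `b`, the square `d` would lie left of both `a` and `c`, yet its shadow meets
      -- one of them.
      b⊲d : b X.⊲ d
      b⊲d with proj₂ level | meets
      ... | inj₂ lt | _ = lt
      ... | inj₁ d⊲b | inj₁ d~a = contradiction (X.⊲-⊑-trans d⊲b b⊑a) (proj₁ d~a)
      ... | inj₁ d⊲b | inj₂ d~c = contradiction (X.⊲-⊑-trans d⊲b b⊑c) (proj₁ d~c)

    -- Both d and e begin within a unit of the right end of b.
    besideOverlap : ∀ {d e} → b X.⊲ d → X.Close e a ⊎ X.Close e c → ¬ d X.⊲ e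
    besideOverlap {d} {e} b⊲d = [ through a~b , through (swap b~c) ]′
      where
      through : ∀ {z} → X.Close z b → X.Close e z → ¬ d X.⊲ e
      through {z} z~b e~z d⊲e with X.⊑-total d z
      ... | inj₁ d⊑z = proj₂ z~b (X.⊲-⊑-trans b⊲d d⊑z)
      ... | inj₂ z⊑d = proj₂ e~z (X.⊑-⊲-trans z⊑d d⊲e)

    -- Turned upside down, this says that the lower square is strictly to the left of the
    -- upper one.
    upperLeft : ∀ {d e} → d ≢ a → Y.Close d b → b X.⊲ d → d Y.⊲ e → b Y.⊑ e →
                e ≢ a → ¬ d X.⊑ e
    upperLeft {d} {e} d≢a d~b b⊲d d⊲e b⊑e e≢a d⊑e with sees e≢a
    ... | inj₂ (e~a , _) = proj₂ e~a (Y.⊲-⊑-trans a⊲b b⊑e)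
    ... | inj₁ (e~a , _) with sees d≢a
    ...   | inj₂ (_ , inj₁ d⊲a) = proj₂ a~b (X.⊲-⊑-trans b⊲d (X.⊲⇒⊑ d⊲a))
    ...   | inj₂ (_ , inj₂ a⊲d) = proj₂ e~a (X.⊲-⊑-trans a⊲d d⊑e)
    ...   | inj₁ (_ , inj₁ d⊲a) = proj₁ d~b (Y.⊲-trans d⊲a a⊲b)
    -- The left end of `d` lies between those of `a` and `e`, so `d` hides them from each other.
    ...   | inj₁ (_ , inj₂ a⊲d) = notBetween A (swap e~a) a⊲d d⊲e (inj₂ d⊑e) (inj₁ a⊑d)
      where
      a⊑d : a X.⊑ d
      a⊑d with X.⊑-total a d
      ... | inj₁ a⊑d = a⊑d
      ... | inj₂ d⊑a = contradiction (X.⊲-⊑-trans b⊲d d⊑a) (proj₂ a~b)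

  module _ {X Y : Intervals I} (A : Arrangement X Y) {a b c d e : I}
           (d≢a : d ≢ a) (d≢b : d ≢ b) (d≢c : d ≢ c)
           (e≢a : e ≢ a) (e≢b : e ≢ b) (e≢c : e ≢ c) (d≢e : d ≢ e) where
    private
      module X = Intervals X
      module Y = Intervals Y
    open Arrangement A

    noLeftTriangle : (T : Triangle X Y a b c) → ¬ Triangle.BulgesLeft T
    noLeftTriangle T bulge
      with sees d≢e | beside A T bulge d≢a d≢b d≢c | beside A T bulge e≢a e≢b e≢c
    ... | inj₂ (_ , inj₁ d⊲e) | (_ , b⊲d , _) | (_ , _ , e~) = besideOverlap A T bulge b⊲d e~ d⊲e
    ... | inj₂ (_ , inj₂ e⊲d) | (_ , _ , d~) | (_ , b⊲e , _) = besideOverlap A T bulge b⊲e d~ e⊲d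
    ... | inj₁ (_ , d∥e) | (d~b , b⊲d , _) | (e~b , b⊲e , _) =
      [ stacked d≢a d≢c e≢a e≢c d~b b⊲d e~b b⊲e , stacked e≢a e≢c d≢a d≢c e~b b⊲e d~b b⊲d ]′ d∥e
      where
      stacked : ∀ {d e} → d ≢ a → d ≢ c → e ≢ a → e ≢ c →
                Y.Close d b → b X.⊲ d → Y.Close e b → b X.⊲ e → ¬ d Y.⊲ e
      stacked {d} {e} d≢a d≢c e≢a e≢c d~b b⊲d e~b b⊲e d⊲e with X.⊑-total d e
      ... | inj₁ d⊑e = upperLeft A T bulge d≢a d~b b⊲d d⊲e b⊑e e≢a d⊑e
        where
        b⊑e : b Y.⊑ e
        b⊑e with Y.⊑-total b e
        ... | inj₁ lt = lt
        ... | inj₂ e⊑b = contradiction (Y.⊲-⊑-trans d⊲e e⊑b) (proj₁ d~b)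
      ... | inj₂ e⊑d = upperLeft (reverseʸ A) (flipTriangle T) (swap bulge)
                         e≢c (swap e~b) b⊲e d⊲e d⊑b d≢c e⊑d
        where
        d⊑b : d Y.⊑ b
        d⊑b with Y.⊑-total d b
        ... | inj₁ lt = lt
        ... | inj₂ b⊑d = contradiction (Y.⊑-⊲-trans b⊑d d⊲e) (proj₂ e~b)

-- Excluding five squares

module _ {n : ℕ} where
  open DecMembership (Fin._≟_ {n}) using (_∈?_)

  fresh : ∀ (xs : List (Fin n)) → length xs ℕ.< n → ∃[ d ] d ∉ xs
  fresh xs <n with any? (λ d → ¬? (d ∈? xs))
  ... | yes found = found
  -- If `xs` contained everything, sending each element to its position in `xs` would be an
  -- injection into too small a set.
  ... | no  none  = contradiction eq (Fin.<⇒≢ i<j)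
    where
    member : ∀ d → d ∈ xs
    member d = decidable-stable (d ∈? xs) λ d∉xs → none (d , d∉xs)
    clash = pigeonhole <n (λ d → index (member d))
    i = proj₁ clash
    j = proj₁ (proj₂ clash)
    i<j = proj₁ (proj₂ (proj₂ clash))
    eq : i ≡ j
    eq = trans (lookup-index (member i))
           (trans (cong (lookup xs) (proj₂ (proj₂ (proj₂ clash)))) (sym (lookup-index (member j))))

module _ {X Y : Intervals (Fin 5)} where
  private
    module X = Intervals X
    module Y = Intervals Y

  -- If `b` bulges to neither side, its left end lies between those of `a` and `c`, so it covers
  -- their common shadow. A bulge to the right is a bulge to the left in the mirror image.
  noTriangle : Arrangement X Y → ∀ {a b c} → ¬ Triangle X Y a b c
  noTriangle A {a} {b} {c} T
    with fresh (a ∷ b ∷ c ∷ []) (from-yes (3 ℕ.<? 5))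
  ... | d , d∉ with fresh (d ∷ a ∷ b ∷ c ∷ []) (from-yes (4 ℕ.<? 5))
  ...   | e , e∉ = bulges (X.⊑-total b a) (X.⊑-total b c)
    where
    open Triangle T

    noLeft : ∀ {X} → Arrangement X Y → (T : Triangle X Y a b c) → ¬ Triangle.BulgesLeft T
    noLeft A = noLeftTriangle A
      (d∉ ∘ here) (d∉ ∘ there ∘ here) (d∉ ∘ there ∘ there ∘ here)
      (e∉ ∘ there ∘ here) (e∉ ∘ there ∘ there ∘ here) (e∉ ∘ there ∘ there ∘ there ∘ here)
      (e∉ ∘ here ∘ sym)

    bulges : b X.⊑ a ⊎ a X.⊑ b → ¬ (b X.⊑ c ⊎ c X.⊑ b)
    bulges (inj₁ b⊑a) (inj₁ b⊑c) = noLeft A T (b⊑a , b⊑c)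
    bulges (inj₂ a⊑b) (inj₂ c⊑b) = noLeft (reverseˣ A) (mirrorTriangle T) (a⊑b , c⊑b)
    bulges (inj₁ b⊑a) (inj₂ c⊑b) = notBetween A a~c a⊲b b⊲c (inj₁ b⊑a) (inj₂ c⊑b)
    bulges (inj₂ a⊑b) (inj₁ b⊑c) = notBetween A a~c a⊲b b⊲c (inj₂ b⊑c) (inj₁ a⊑b)

  noVerticalClique : Arrangement X Y → ∀ {i j k} →
                     Vertical X Y i j → Vertical X Y i k → ¬ Vertical X Y j k
  noVerticalClique A {i} {j} {k} (i~j , i∥j) (i~k , i∥k) (j~k , j∥k) = sort i∥j i∥k j∥k
    where
    j~i = swap i~j
    k~i = swap i~k
    k~j = swap j~k

    triangle : ∀ {a b c} → X.Close a b → X.Close b c → X.Close a c → a Y.⊲ b → ¬ b Y.⊲ c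
    triangle ab bc ac a⊲b b⊲c =
      noTriangle A record { a⊲b = a⊲b ; b⊲c = b⊲c ; a~b = ab ; b~c = bc ; a~c = ac }

    sort : Y.Apart i j → Y.Apart i k → ¬ Y.Apart j k
    -- The wildcards here and in the last clause also absorb the two cyclic combinations: two of the
    -- comparisons already form a chain.
    sort (inj₁ ij) _         (inj₁ jk) = triangle i~j j~k i~k ij jk
    sort (inj₁ ij) (inj₁ ik) (inj₂ kj) = triangle i~k k~j i~j ik kj
    sort (inj₁ ij) (inj₂ ki) (inj₂ kj) = triangle k~i i~j k~j ki ij
    sort (inj₂ ji) (inj₁ ik) (inj₁ jk) = triangle j~i i~k j~k ji ik
    sort (inj₂ ji) (inj₂ ki) (inj₁ jk) = triangle j~k k~i j~i jk ki
    sort (inj₂ ji) _         (inj₂ kj) = triangle k~j j~i k~i kj ji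

noFiveSquares : ∀ {X Y : Intervals (Fin 5)} → ¬ Arrangement X Y
noFiveSquares {X} {Y} A = pick (others 0F) (others 1F) (others 2F) (others 3F)
  where
  module X = Intervals X
  open Arrangement A

  m : Fin 5
  m = proj₁ (X.leftmost id)

  m⊑ : ∀ i → m X.⊑ i
  m⊑ = proj₂ (X.leftmost id)

  o : Fin 4 → Fin 5
  o = punchIn m

  V H : Fin 5 → Fin 5 → Set
  V = Vertical X Y
  H = Vertical Y X

  others : ∀ i → V m (o i) ⊎ H m (o i)
  others i = sees (≢-sym (punchInᵢ≢i m i))

  sees′ : ∀ {i j} → i ≢ j → V (o i) (o j) ⊎ H (o i) (o j)
  sees′ i≢j = sees (i≢j ∘ punchIn-injective m _ _)

  -- Vertical neighbours of the leftmost square begin within a unit of its left side, so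
  -- their vertical shadows overlap.
  twoV : ∀ {i j} → i ≢ j → V m (o i) → ¬ V m (o j)
  twoV {i} {j} i≢j mi mj with sees′ i≢j
  ... | inj₁ ij = noVerticalClique A mi mj ij
  ... | inj₂ (_ , inj₁ ij) = proj₁ (proj₁ mj) (X.⊑-⊲-trans (m⊑ (o i)) ij)
  ... | inj₂ (_ , inj₂ ji) = proj₁ (proj₁ mi) (X.⊑-⊲-trans (m⊑ (o j)) ji)

  -- A horizontal pair closes a triangle with `m`; without one, the three form a vertical triangle.
  -- This is the Ramsey argument for six points, and `twoV`, by the choice of `m`, makes it work for
  -- five.
  threeH : ∀ {i j k} → i ≢ j → i ≢ k → j ≢ k → H m (o i) → H m (o j) → ¬ H m (o k)
  threeH i≢j i≢k j≢k mi mj mk with sees′ i≢j | sees′ i≢k | sees′ j≢k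
  ... | inj₂ ij | _       | _       = noVerticalClique (transpose A) mi mj ij
  ... | _       | inj₂ ik | _       = noVerticalClique (transpose A) mi mk ik
  ... | _       | _       | inj₂ jk = noVerticalClique (transpose A) mj mk jk
  ... | inj₁ ij | inj₁ ik | inj₁ jk = noVerticalClique A ij ik jk

  pick : V m (o 0F) ⊎ H m (o 0F) → V m (o 1F) ⊎ H m (o 1F) →
         V m (o 2F) ⊎ H m (o 2F) → ¬ (V m (o 3F) ⊎ H m (o 3F))
  pick (inj₁ v₀) (inj₁ v₁) _         _         = twoV (λ ()) v₀ v₁
  pick (inj₁ v₀) (inj₂ h₁) (inj₁ v₂) _         = twoV (λ ()) v₀ v₂
  pick (inj₁ v₀) (inj₂ h₁) (inj₂ h₂) (inj₁ v₃) = twoV (λ ()) v₀ v₃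
  pick (inj₁ v₀) (inj₂ h₁) (inj₂ h₂) (inj₂ h₃) = threeH (λ ()) (λ ()) (λ ()) h₁ h₂ h₃
  pick (inj₂ h₀) (inj₁ v₁) (inj₁ v₂) _         = twoV (λ ()) v₁ v₂
  pick (inj₂ h₀) (inj₁ v₁) (inj₂ h₂) (inj₁ v₃) = twoV (λ ()) v₁ v₃
  pick (inj₂ h₀) (inj₁ v₁) (inj₂ h₂) (inj₂ h₃) = threeH (λ ()) (λ ()) (λ ()) h₀ h₂ h₃
  pick (inj₂ h₀) (inj₂ h₁) (inj₁ v₂) (inj₁ v₃) = twoV (λ ()) v₂ v₃
  pick (inj₂ h₀) (inj₂ h₁) (inj₁ v₂) (inj₂ h₃) = threeH (λ ()) (λ ()) (λ ()) h₀ h₁ h₃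
  pick (inj₂ h₀) (inj₂ h₁) (inj₂ h₂) _         = threeH (λ ()) (λ ()) (λ ()) h₀ h₁ h₂

-- From visibility layouts to arrangements

-- Double negation commutes with products over finite index sets.
¬¬-decidable : ∀ {n} (R : Fin n → Fin n → Set) → ¬ ¬ (∀ i j → Dec (R i j))
¬¬-decidable R = sequence applicative λ i → sequence applicative λ j → ¬¬-excluded-middle
  where applicative = RawMonad.rawApplicative ¬¬-Monad

intervals : ∀ {n} (x : Fin n → ℝ) → (∀ i j → Dec (x i < x j)) → Intervals (Fin n)
intervals x _<?_ = record
  { _⊑_       = λ i j → x i ≤ x j
  ; _⊲_       = λ i j → x i ⊕ 1ℚ ≤ x j
  ; ⊑-total   = total
  ; ⊑-trans   = λ {i} {j} {k} → ≤-trans {x i} {x j} {x k}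
  ; ⊲⇒⊑       = λ {i} {j} → ≤-trans {x i} {x i ⊕ 1ℚ} {x j} (x≤x⊕1 (x i))
  -- `x i ⊕ 1ℚ ≤ x i` unfolds to `¬ (x i < x i ⊕ 1ℚ)`.
  ; ⊲-irrefl  = λ {i} → ¬¬x<x⊕1 (x i)
  ; ⊑-⊲-trans = λ {i} {j} {k} i⊑j → ≤-trans {x i ⊕ 1ℚ} {x j ⊕ 1ℚ} {x k}
                                    (⊕-mono-≤ {x i} {x j} 1ℚ i⊑j)
  ; ⊲-⊑-trans = λ {i} {j} {k} → ≤-trans {x i ⊕ 1ℚ} {x j} {x k}
  }
  where
  total : ∀ i j → x i ≤ x j ⊎ x j ≤ x i
  total i j with i <? j
  ... | yes i<j = inj₁ (<⇒≤ {x i} {x j} i<j)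
  ... | no  i≮j = inj₂ i≮j

Complete : ∀ {n} → Layout n → Set₁
Complete S = ∀ {v w} → v ≢ w → Visible S v w

module _ {n} {S : Layout n} where

  private
    x y : Fin n → ℝ
    x = proj₁ ∘ S
    y = proj₂ ∘ S

  Sightline : Fin n → Fin n → ℝ → Set
  Sightline v w t = (y v < t × t < y v ⊕ 1ℚ) × (y w < t × t < y w ⊕ 1ℚ)

  sightline : ∀ {v w} (B : HorizontalBand S v w) → let open HorizontalBand B in
              ∃[ t ] (lo < t × t < hi × Sightline v w t)
  sightline B = let (t , lo<t , t<hi) = <-dense {lo} {hi} lo<hi
                    ((_ , _ , v) , (_ , _ , w)) = meets t lo<t t<hi
                in t , lo<t , t<hi , v , w
    where open HorizontalBand B

  band⇒close : ∀ {v w} → HorizontalBand S v w → y w < y v ⊕ 1ℚ × y v < y w ⊕ 1ℚ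
  band⇒close {v} {w} B = let (t , _ , _ , (v<t , t<v+1) , (w<t , t<w+1)) = sightline B in
    <-trans {y w} {t} {y v ⊕ 1ℚ} w<t t<v+1 , <-trans {y v} {t} {y w ⊕ 1ℚ} v<t t<w+1

  -- If the abscissas overlapped as well, a point of the overlap on a sightline would be interior to
  -- both squares.
  band⇒apart : (∀ i j → Dec (x i < x j)) → DisjointInteriors S → ∀ {v w} → v ≢ w →
               HorizontalBand S v w → ¬ (x w < x v ⊕ 1ℚ × x v < x w ⊕ 1ℚ)
  band⇒apart _<?_ D {v} {w} v≢w B (w<v+1 , v<w+1) with sightline B | v <? w
  ... | t , _ , _ , tv , tw | yes v<w =
    let (s , w<s , s<v+1) = <-dense {x w} {x v ⊕ 1ℚ} w<v+1 in
    D v≢w (s , t) ( ((<-trans {x v} {x w} {s} v<w w<s , s<v+1) , tv)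
                  , ((w<s , <-trans {s} {x v ⊕ 1ℚ} {x w ⊕ 1ℚ} s<v+1
                             (⊕-mono-< {x v} {x w} 1ℚ v<w)) , tw))
  ... | t , _ , _ , tv , tw | no w≤v =
    let (s , v<s , s<w+1) = <-dense {x v} {x w ⊕ 1ℚ} v<w+1 in
    D v≢w (s , t) ( ((v<s , <-≤-trans {s} {x w ⊕ 1ℚ} {x v ⊕ 1ℚ} s<w+1
                             (⊕-mono-≤ {x w} {x v} 1ℚ w≤v)) , tv)
                  , ((≤-<-trans {x w} {x v} {s} w≤v v<s , s<w+1) , tw))

  blocks : ∀ {i k p} (B : HorizontalBand S i k) → let open HorizontalBand B in
           x i ⊕ 1ℚ ≤ x p → x p ⊕ 1ℚ ≤ x k →
           ∀ {t} → lo < t → t < hi → y p < t → ¬ t < y p ⊕ 1ℚ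
  blocks {i} {k} {p} B i⊲p p⊲k {t} lo<t t<hi p<t t<p+1 = ¬¬x<x⊕1 (x p) λ p<p+1 →
    let (s , p<s , s<p+1) = <-dense {x p} {x p ⊕ 1ℚ} p<p+1 in
    unobstructed t lo<t t<hi s
      (inj₁ ( ≤-trans {x i ⊕ 1ℚ} {x p} {s} i⊲p (<⇒≤ {x p} {s} p<s)
            , ≤-trans {s} {x p ⊕ 1ℚ} {x k} (<⇒≤ {s} {x p ⊕ 1ℚ} s<p+1) p⊲k))
      p (λ { refl → ¬¬x<x⊕1 (x p) i⊲p }) (λ { refl → ¬¬x<x⊕1 (x p) p⊲k })
      ((p<s , s<p+1) , p<t , t<p+1)
    where open HorizontalBand B

module _ {n} (S : Layout n) where

  private
    x y : Fin n → ℝ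
    x = proj₁ ∘ S
    y = proj₂ ∘ S

  -- By completeness `i` and `k` see each other, and horizontally, as `i ⊲ k` rules out a vertical
  -- band. A sightline at height `t` avoids `p` but runs above its lower side, so `p` ends at or
  -- below `t`; dually `q` begins at or above `t`.
  complete⇒unblocked : ∀ dx dy → Complete S → Unblocked (intervals y dy) (intervals x dx)
  complete⇒unblocked dx dy C {i} {k} {p} {q} _ i⊲p p⊲k i⊲q q⊲k p⊑ ⊑q q<p+1 =
    [ horizontal , (λ V → i⊲k (proj₁ (band⇒close {S = swap ∘ S} V))) ]′ (C i≢k)
    where
    i⊲k : x i ⊕ 1ℚ ≤ x k
    i⊲k = Intervals.⊲-trans (intervals x dx) {i} {p} {k} i⊲p p⊲k

    i≢k : i ≢ k
    i≢k refl = ¬¬x<x⊕1 (x i) i⊲k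

    horizontal : ¬ HorizontalBand S i k
    horizontal B with sightline B
    ... | t , lo<t , t<hi , (i<t , t<i+1) , (k<t , t<k+1) =
      ≤-trans {y p ⊕ 1ℚ} {t} {y q} p+1≤t t≤q q<p+1
      where
      p<t : y p < t
      p<t = [ (λ p⊑i → ≤-<-trans {y p} {y i} {t} p⊑i i<t)
            , (λ p⊑k → ≤-<-trans {y p} {y k} {t} p⊑k k<t) ]′ p⊑

      t<q+1 : t < y q ⊕ 1ℚ
      t<q+1 = [ (λ i⊑q → <-≤-trans {t} {y i ⊕ 1ℚ} {y q ⊕ 1ℚ} t<i+1 (⊕-mono-≤ {y i} {y q} 1ℚ i⊑q))
              , (λ k⊑q → <-≤-trans {t} {y k ⊕ 1ℚ} {y q ⊕ 1ℚ} t<k+1 (⊕-mono-≤ {y k} {y q} 1ℚ k⊑q)) ]′ ⊑q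

      p+1≤t : y p ⊕ 1ℚ ≤ t
      p+1≤t = blocks B i⊲p p⊲k {t} lo<t t<hi p<t

      t≤q : t ≤ y q
      t≤q q<t = blocks B i⊲q q⊲k {t} lo<t t<hi q<t t<q+1

  band⇒vertical : ∀ dx dy (dx′ : ∀ i j → Dec (x j < x i ⊕ 1ℚ)) → DisjointInteriors S →
                  ∀ {v w} → v ≢ w → HorizontalBand S v w →
                  Vertical (intervals y dy) (intervals x dx) v w
  band⇒vertical dx dy dx′ D {v} {w} v≢w B =
    ((λ v⊲w → v⊲w (proj₁ (band⇒close B))) , (λ w⊲v → w⊲v (proj₂ (band⇒close B)))) , apart
    where
    apart : x v ⊕ 1ℚ ≤ x w ⊎ x w ⊕ 1ℚ ≤ x v
    -- `band⇒apart` merely refutes a conjunction; `dx′` turns this into the required disjunction.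
    apart with dx′ v w | dx′ w v
    ... | no v⊲w  | _       = inj₁ v⊲w
    ... | yes _   | no w⊲v  = inj₂ w⊲v
    ... | yes v~w | yes w~v = contradiction (v~w , w~v) (band⇒apart dx D v≢w B)

arrangement : ∀ {n} (S : Layout n) → DisjointInteriors S → Complete S →
              ¬ ¬ (∃[ X ] ∃[ Y ] Arrangement X Y)
arrangement S D C none =
  ¬¬-decidable (λ i j → x i < x j) λ dx →
  ¬¬-decidable (λ i j → y i < y j) λ dy →
  ¬¬-decidable (λ i j → x j < x i ⊕ 1ℚ) λ dx′ →
  ¬¬-decidable (λ i j → y j < y i ⊕ 1ℚ) λ dy′ →
  none (intervals x dx , intervals y dy , record
    { sees       = λ v≢w → Sum.swap (Sum.map (band⇒vertical S dx dy dx′ D v≢w)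
                             (band⇒vertical (swap ∘ S) dy dx dy′ Dᵀ v≢w) (C v≢w))
    ; unblocked  = λ {i} {k} {p} {q} →
        complete⇒unblocked (swap ∘ S) dy dx (Sum.swap ∘ C) {i} {k} {p} {q}
    ; unblockedᵀ = λ {i} {k} {p} {q} →
        complete⇒unblocked S dx dy C {i} {k} {p} {q}
    })
  where
  x = proj₁ ∘ S
  y = proj₂ ∘ S

  Dᵀ : DisjointInteriors (swap ∘ S)
  Dᵀ v≢w p (v , w) = D v≢w (swap p) (swap v , swap w)

-- Passing to fewer squares

restrictBand : ∀ {m n} {S : Layout n} {f : Fin m → Fin n} → Injective _≡_ _≡_ f →
               ∀ {v w} → HorizontalBand S (f v) (f w) → HorizontalBand (S ∘ f) v w
restrictBand {f = f} f-inj B = record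
  { lo = lo ; hi = hi ; lo<hi = lo<hi ; meets = meets
  ; unobstructed = λ y lo<y y<hi x between u u≢v u≢w →
      unobstructed y lo<y y<hi x between (f u) (u≢v ∘ f-inj) (u≢w ∘ f-inj)
  }
  where open HorizontalBand B

-- Deleting squares keeps the bands of the remaining pairs. It might create new ones, which is
-- harmless in a complete graph.
K-restrict : ∀ {m n} → m ≤ℕ n → IsURVG (K n) → IsURVG (K m)
K-restrict {m} {n} m≤n (S , D , C) = S ∘ f , (λ v≢w → D (v≢w ∘ f-inj)) , λ v≢w → mk⇔
  (λ _ → Sum.map (restrictBand {S = S} f-inj) (restrictBand {S = swap ∘ S} f-inj)
           (Equivalence.to (C (v≢w ∘ f-inj)) (v≢w ∘ f-inj)))
  (λ _ → v≢w)
  where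
  f : Fin m → Fin n
  f i = inject≤ i m≤n

  f-inj : Injective _≡_ _≡_ f
  f-inj = inject≤-injective m≤n m≤n _ _

K₅-not-URVG : ¬ IsURVG (K 5)
K₅-not-URVG (S , D , C) =
  arrangement S D (λ v≢w → Equivalence.to (C v≢w) v≢w) λ (_ , _ , A) → noFiveSquares A

-- A layout of four squares

fromℚ-⊕-≤ : ∀ {p q r} → p + r ℚ.≤ q → fromℚ p ⊕ r ≤ fromℚ q
fromℚ-⊕-≤ {p} {q} {r} p+r≤q (s , q<s , s-r<p) =
  ℚ.<-asym q<s (ℚ.<-≤-trans (subst (ℚ._< p + r) (//-rightDividesˡ r s) (ℚ.+-monoˡ-< r s-r<p)) p+r≤q)

≤-fromℚ-⊕ : ∀ {p q r} → q ℚ.≤ p + r → fromℚ q ≤ fromℚ p ⊕ r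
≤-fromℚ-⊕ {p} {q} {r} q≤p+r (s , p<s-r , s<q) =
  ℚ.<-asym s<q (ℚ.≤-<-trans q≤p+r (subst (p + r ℚ.<_) (//-rightDividesˡ r s) (ℚ.+-monoˡ-< r p<s-r)))

-- `LineMeets` asks for an actual abscissa, for which the doubly negated `¬¬x<x⊕1` is too weak.
fromℚ-<-⊕1 : ∀ p → fromℚ p < fromℚ p ⊕ 1ℚ
fromℚ-<-⊕1 p = p + ½
  , subst (ℚ._< p + ½) (ℚ.+-identityʳ p) (ℚ.+-monoʳ-< p (from-yes (0ℚ ℚ.<? ½)))
  , subst (ℚ._< p) (sym (ℚ.+-assoc p ½ (- 1ℚ)))
      (subst (p + (½ - 1ℚ) ℚ.<_) (ℚ.+-identityʳ p) (ℚ.+-monoʳ-< p (from-yes (½ - 1ℚ ℚ.<? 0ℚ))))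

module _ {n} (x y : Fin n → ℚ) where

  layout : Layout n
  layout v = fromℚ (x v) , fromℚ (y v)

  Separated : Fin n → Fin n → Set
  Separated v w = (x v + 1ℚ ℚ.≤ x w ⊎ x w + 1ℚ ℚ.≤ x v) ⊎ (y v + 1ℚ ℚ.≤ y w ⊎ y w + 1ℚ ℚ.≤ y v)

  separated? : ∀ v w → Dec (Separated v w)
  separated? v w = (x v + 1ℚ ℚ.≤? x w ⊎-dec x w + 1ℚ ℚ.≤? x v) ⊎-dec
                   (y v + 1ℚ ℚ.≤? y w ⊎-dec y w + 1ℚ ℚ.≤? y v)

  -- A sufficient condition, decidable over the rationals. Comparing left ends is enough: a square
  -- beginning no later than `v` and `w` also ends no later than they do.
  OutOfTheWay : (v w : Fin n) (lo hi : ℚ) → Fin n → Set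
  OutOfTheWay v w lo hi u =
    (hi ℚ.≤ y u ⊎ y u + 1ℚ ℚ.≤ lo) ⊎
    (x u ℚ.≤ x v × x u ℚ.≤ x w) ⊎ (x v ℚ.≤ x u × x w ℚ.≤ x u)

  Seen : (v w : Fin n) (lo hi : ℚ) → Set
  Seen v w lo hi =
    lo ℚ.< hi × (y v ℚ.≤ lo × hi ℚ.≤ y v + 1ℚ) × (y w ℚ.≤ lo × hi ℚ.≤ y w + 1ℚ) ×
    (∀ u → (u ≡ v ⊎ u ≡ w) ⊎ OutOfTheWay v w lo hi u)

  seen? : ∀ v w lo hi → Dec (Seen v w lo hi)
  seen? v w lo hi =
    lo ℚ.<? hi ×-dec (y v ℚ.≤? lo ×-dec hi ℚ.≤? y v + 1ℚ) ×-dec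
    (y w ℚ.≤? lo ×-dec hi ℚ.≤? y w + 1ℚ) ×-dec
    all? λ u → (u Fin.≟ v ⊎-dec u Fin.≟ w) ⊎-dec
      ((hi ℚ.≤? y u ⊎-dec y u + 1ℚ ℚ.≤? lo) ⊎-dec
       (x u ℚ.≤? x v ×-dec x u ℚ.≤? x w) ⊎-dec (x v ℚ.≤? x u ×-dec x w ℚ.≤? x u))

  layout-meets : ∀ {v t} lo hi → y v ℚ.≤ lo → hi ℚ.≤ y v + 1ℚ →
                 fromℚ lo < t → t < fromℚ hi → LineMeets t (layout v)
  layout-meets {v} {t} lo hi yv≤lo hi≤yv+1 lo<t t<hi =
    let (s , xv<s , s<xv+1) = <-dense {fromℚ (x v)} {fromℚ (x v) ⊕ 1ℚ} (fromℚ-<-⊕1 (x v)) in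
    s , (xv<s , s<xv+1)
      , ≤-<-trans {fromℚ (y v)} {fromℚ lo} {t} (fromℚ-mono-≤ yv≤lo) lo<t
      , <-≤-trans {t} {fromℚ hi} {fromℚ (y v) ⊕ 1ℚ} t<hi (≤-fromℚ-⊕ hi≤yv+1)

  seen⇒band : ∀ {v w} lo hi → Seen v w lo hi → HorizontalBand layout v w
  seen⇒band {v} {w} lo hi (lo<hi , (v≤lo , hi≤v+1) , (w≤lo , hi≤w+1) , clear) = record
    { lo = fromℚ lo ; hi = fromℚ hi
    -- Between embedded rationals, `<` unfolds to the existence of a rational strictly in between.
    ; lo<hi = ℚ.<-dense lo<hi
    ; meets = λ t lo<t t<hi → layout-meets {v} {t} lo hi v≤lo hi≤v+1 lo<t t<hi
                            , layout-meets {w} {t} lo hi w≤lo hi≤w+1 lo<t t<hi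
    ; unobstructed = λ t lo<t t<hi s between u u≢v u≢w inside →
        [ [ u≢v , u≢w ]′ , (λ out → clearance t lo<t t<hi s between u out inside) ]′ (clear u)
    }
    where
    right left : Fin n → ℝ
    left u = fromℚ (x u)
    right u = left u ⊕ 1ℚ

    clearance : ∀ t → fromℚ lo < t → t < fromℚ hi → ∀ s → Between (layout v) (layout w) s →
                ∀ u → OutOfTheWay v w lo hi u → ¬ (s , t) ∈Interior layout u
    clearance t lo<t t<hi s _ u (inj₁ (inj₁ hi≤u)) (_ , u<t , _) =
      fromℚ-mono-≤ hi≤u (<-trans {fromℚ (y u)} {t} {fromℚ hi} u<t t<hi)
    clearance t lo<t t<hi s _ u (inj₁ (inj₂ u+1≤lo)) (_ , _ , t<u+1) =
      fromℚ-⊕-≤ u+1≤lo (<-trans {fromℚ lo} {t} {fromℚ (y u) ⊕ 1ℚ} lo<t t<u+1)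
    clearance t _ _ s between u (inj₂ (inj₁ (u≤v , u≤w))) ((_ , s<u+1) , _) =
      [ (λ (v+1≤s , _) → beyond v u≤v v+1≤s) , (λ (w+1≤s , _) → beyond w u≤w w+1≤s) ]′ between
      where
      beyond : ∀ z → x u ℚ.≤ x z → ¬ right z ≤ s
      beyond z u≤z z+1≤s = ⊕-mono-≤ {left u} {left z} 1ℚ (fromℚ-mono-≤ u≤z)
                             (≤-<-trans {right z} {s} {right u} z+1≤s s<u+1)
    clearance t _ _ s between u (inj₂ (inj₂ (v≤u , w≤u))) ((u<s , _) , _) =
      [ (λ (_ , s≤w) → beyond w w≤u s≤w) , (λ (_ , s≤v) → beyond v v≤u s≤v) ]′ between
      where
      beyond : ∀ z → x z ℚ.≤ x u → ¬ s ≤ left z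
      beyond z z≤u s≤z = fromℚ-mono-≤ z≤u (<-≤-trans {left u} {s} {left z} u<s s≤z)

  separated⇒disjoint : ∀ {v w} → Separated v w →
                       ∀ p → ¬ (p ∈Interior layout v × p ∈Interior layout w)
  separated⇒disjoint s (a , b) ((va , vb) , (wa , wb)) =
    [ [ ends a va wa , ends a wa va ]′ , [ ends b vb wb , ends b wb vb ]′ ]′ s
    where
    ends : ∀ {p q} s → fromℚ p < s × s < fromℚ p ⊕ 1ℚ → fromℚ q < s × s < fromℚ q ⊕ 1ℚ →
           ¬ p + 1ℚ ℚ.≤ q
    ends {p} {q} s (_ , s<p+1) (q<s , _) p+1≤q =
      fromℚ-⊕-≤ p+1≤q (<-trans {fromℚ q} {s} {fromℚ p ⊕ 1ℚ} q<s s<p+1)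

--     +---+
--     | 2 |
--   +---+---+
--   | 1 | 3 |
--   +---+---+
--     | 0 |
--     +---+
-- with a gap between squares 1 and 3 through which 0 sees 2.
x₄ y₄ : Fin 4 → ℚ
x₄ 0F = ½
x₄ 1F = 0ℚ
x₄ 2F = ½
x₄ 3F = + 5 ℚ./ 4
y₄ 0F = 0ℚ
y₄ 1F = 1ℚ
y₄ 2F = + 2 ℚ./ 1
y₄ 3F = 1ℚ

horizontal : ∀ {v w} lo hi {_ : True (seen? x₄ y₄ v w lo hi)} → Visible (layout x₄ y₄) v w
horizontal lo hi {s} = inj₁ (seen⇒band x₄ y₄ lo hi (toWitness s))

vertical : ∀ {v w} lo hi {_ : True (seen? y₄ x₄ v w lo hi)} → Visible (layout x₄ y₄) v w
vertical lo hi {s} = inj₂ (seen⇒band y₄ x₄ lo hi (toWitness s))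

visible₄ : ∀ {v w} → v ≢ w → Visible (layout x₄ y₄) v w
visible₄ {0F} {0F} 0≢0 = contradiction refl 0≢0
visible₄ {0F} {1F} _ = vertical ½ 1ℚ
-- The gap runs from the right side of square 1, at 1, to the left side of square 3, at 5/4.
visible₄ {0F} {2F} _ = vertical 1ℚ (+ 5 ℚ./ 4)
visible₄ {0F} {3F} _ = vertical (+ 5 ℚ./ 4) (+ 3 ℚ./ 2)
visible₄ {1F} {0F} _ = vertical ½ 1ℚ
visible₄ {1F} {1F} 1≢1 = contradiction refl 1≢1
visible₄ {1F} {2F} _ = vertical ½ 1ℚ
visible₄ {1F} {3F} _ = horizontal 1ℚ (+ 2 ℚ./ 1)
visible₄ {2F} {0F} _ = vertical 1ℚ (+ 5 ℚ./ 4)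
visible₄ {2F} {1F} _ = vertical ½ 1ℚ
visible₄ {2F} {2F} 2≢2 = contradiction refl 2≢2
visible₄ {2F} {3F} _ = vertical (+ 5 ℚ./ 4) (+ 3 ℚ./ 2)
visible₄ {3F} {0F} _ = vertical (+ 5 ℚ./ 4) (+ 3 ℚ./ 2)
visible₄ {3F} {1F} _ = horizontal 1ℚ (+ 2 ℚ./ 1)
visible₄ {3F} {2F} _ = vertical (+ 5 ℚ./ 4) (+ 3 ℚ./ 2)
visible₄ {3F} {3F} 3≢3 = contradiction refl 3≢3

separated₄ : ∀ v w → v ≡ w ⊎ Separated x₄ y₄ v w
separated₄ = toWitness {a? = all? λ v → all? λ w → v Fin.≟ w ⊎-dec separated? x₄ y₄ v w} _

K₄-URVG : IsURVG (K 4)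
K₄-URVG = layout x₄ y₄
  , (λ {v} {w} v≢w → [ (λ v≡w → contradiction v≡w v≢w)
                      , separated⇒disjoint x₄ y₄ {v} {w} ]′ (separated₄ v w))
  , λ v≢w → mk⇔ (λ _ → visible₄ v≢w) (λ _ → v≢w)

theorem3p3 : ∀ (n : ℕ) → 1 ≤ℕ n → IsURVG (K n) ⇔ n ≤ℕ 4
theorem3p3 n _ = mk⇔
  (λ urvg → ℕ.≮⇒≥ λ 4<n → K₅-not-URVG (K-restrict 4<n urvg))
  (λ n≤4 → K-restrict n≤4 K₄-URVG)
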